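{- For each $k\ge1$, the classification strategy $\mathcal{N}_k$ is asymptotically optimal, i.e., there is a constant $\varepsilon>0$ such that its average comparison count for classifying the $n-k$ non-pivot elements differs from that of the optimal strategy $\mathcal{O}_k$ by at most $O(n^{1-\varepsilon})$.
   Context: Input: a uniformly random permutation $(e_1,\dots,e_n)$ of $\{1,\dots,n\}$, $n>k$; pivots $p_1<\dots<p_k$ are $e_1,\dots,e_k$ sorted, $p_0=0,p_{k+1}=n+1$; $x$ belongs to group $A_h$ if $p_h<x<p_{h+1}$, and $a_h=p_{h+1}-p_h-1$. A comparison tree is a binary search tree with inner nodes labeled $p_1,\dots,p_k$ in inorder and leaves $A_0,\dots,A_k$ left to right; classifying an $A_h$-element with $\lambda$ costs $\mathrm{depth}_\lambda(A_h)$ comparisons; $\mathrm{cost}^\lambda(a'_0,\dots,a'_k)=\sum_i\mathrm{depth}_\lambda(A_i)a'_i$. A classification strategy classifies $e_{k+1},\dots,e_n$ one at a time, at each step choosing the comparison tree to use as a function of the pivots and the outcomes so far; $a^v_h$ is the number of elements classified into $A_h$ before the current step $v$. Strategy $\mathcal{O}_k$ uses at step $v$ a comparison tree minimizing $\mathrm{cost}^\lambda(a_0-a^v_0,\dots,a_k-a^v_k)$; strategy $\mathcal{N}_k$ uses at every step one fixed comparison tree minimizing $\mathrm{cost}^\lambda(a_0,\dots,a_k)$ over all comparison trees $\lambda$. -}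

module Defs where

open import Data.Nat using (ℕ; zero; suc; _+_; _*_; _∸_; _<ᵇ_)
open import Data.Bool using (if_then_else_)
open import Data.Fin using (Fin; zero; suc; inject₁; splitAt)
open import Data.Sum using (inj₁; inj₂)
open import Data.List using (List; []; _∷_; map; concatMap; take; drop; upTo)
open import Data.Nat.ListAction using (sum)
open import Data.Vec as Vec using (Vec; []; _∷_; lookup; tabulate; zipWith)
open import Data.Product using (Σ; proj₁)
open import Data.Nat using (_≤_)

-- Comparison trees.  `Tree m` is a binary search tree with m leaves
-- (hence m ∸ 1 inner nodes).  Inner nodes are implicitly labelled by the
-- pivots in inorder and leaves by the groups A_0,…,A_{m-1} left to right.
-- A comparison tree for k pivots is an element of `Tree (suc k)`.

data Tree : ℕ → Set where
  leaf : Tree 1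
  node : ∀ {a b} → Tree (suc a) → Tree (suc b) → Tree (suc a + suc b)

-- depth of leaf i (the number of comparisons to classify an element of A_i)
depth : ∀ {m} → Tree m → Fin m → ℕ
depth leaf _ = 0
depth (node {a} {b} l r) i with splitAt (suc a) i
... | inj₁ j = suc (depth l j)
... | inj₂ j = suc (depth r j)

cost : ∀ {m} → Tree m → Vec ℕ m → ℕ
cost {m} t a = Vec.sum (tabulate λ i → depth t i * lookup a i)

MinTree : ∀ {m} → Vec ℕ m → Set
MinTree {m} a = Σ (Tree m) λ t → ∀ (t' : Tree m) → cost t a ≤ cost t' a

-- Groups.  With pivots p_1,…,p_k, the element x lies in group A_h where
-- h = #{ i | p_i < x }  (for a non-pivot x, p_h < x < p_{h+1}).

group : ∀ {k} → Vec ℕ k → ℕ → Fin (suc k)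
group [] x = zero
group (p ∷ ps) x = if p <ᵇ x then suc (group ps x) else inject₁ (group ps x)

counts : ∀ {m} → List (Fin m) → Vec ℕ m
counts {m} [] = Vec.replicate m 0
counts {m} (g ∷ gs) = zipWith _+_ (tabulate λ i → bump g i) (counts gs)
  where
  bump : ∀ {m} → Fin m → Fin m → ℕ
  bump zero zero = 1
  bump zero (suc _) = 0
  bump (suc _) zero = 0
  bump (suc g) (suc i) = bump g i

insertions : ℕ → List ℕ → List (List ℕ)
insertions x [] = (x ∷ []) ∷ []
insertions x (y ∷ ys) = (x ∷ y ∷ ys) ∷ map (y ∷_) (insertions x ys)

permutations : List ℕ → List (List ℕ)
permutations [] = [] ∷ []
permutations (x ∷ xs) = concatMap (insertions x) (permutations xs)

oneTo : ℕ → List ℕ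
oneTo n = map suc (upTo n)

-- the first k entries as a vector (padding never happens since n > k)
takeV : (k : ℕ) → List ℕ → Vec ℕ k
takeV zero _ = []
takeV (suc k) [] = 0 ∷ takeV k []
takeV (suc k) (x ∷ xs) = x ∷ takeV k xs

-- pivots p_1,…,p_k (as a multiset; group only depends on the set)
pivots : (k : ℕ) → List ℕ → Vec ℕ k
pivots k e = takeV k e

groupSeq : (k : ℕ) → List ℕ → List (Fin (suc k))
groupSeq k e = map (group (pivots k e)) (drop k e)

sizes : (k : ℕ) → List ℕ → Vec ℕ (suc k)
sizes k e = counts (groupSeq k e)

-- Strategies.  Tie-breaking among minimizing trees is arbitrary, so a
-- strategy is given by a selector returning a minimizing tree.

SelectorN : ℕ → Set
SelectorN k = (a : Vec ℕ (suc k)) → MinTree a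

-- O_k: at each step a tree minimizing cost^λ(a_0 - a^v_0,…,a_k - a^v_k);
-- the choice may depend on the pivots (via a) and on the full history of
-- outcomes (list of groups classified so far, most recent first)
SelectorO : ℕ → Set
SelectorO k = (a : Vec ℕ (suc k)) → (hist : List (Fin (suc k))) →
              MinTree (zipWith _∸_ a (counts hist))

costN : (k : ℕ) → SelectorN k → List ℕ → ℕ
costN k sel e = sum (map (depth (proj₁ (sel (sizes k e)))) (groupSeq k e))

costO : (k : ℕ) → SelectorO k → List ℕ → ℕ
costO k sel e = go [] (groupSeq k e)
  where
  a = sizes k e
  go : List (Fin (suc k)) → List (Fin (suc k)) → ℕ
  go hist [] = 0
  go hist (g ∷ gs) = depth (proj₁ (sel a hist)) g + go (g ∷ hist) gs

-- total comparison counts over all n! inputs (average = total / n!)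
totalN : (k n : ℕ) → SelectorN k → ℕ
totalN k n sel = sum (map (costN k sel) (permutations (oneTo n)))

totalO : (k n : ℕ) → SelectorO k → ℕ
totalO k n sel = sum (map (costO k sel) (permutations (oneTo n)))

{-# OPTIONS --safe #-}

-- Fix the pivots and let r elements, s_h of them in A_h, be still unclassified; N = n − k and a are the initial values.
-- The remaining order is uniform, so the expected cost of the next step is cost^λ(s) / r for the tree λ in use. Hence
-- O_k is at most N_k in expectation, and as N_k's tree is optimal for a, its excess over O_k's tree is at most
-- 2 depth · Σ_h |N s_h − r a_h| / (N r). Removing a uniformly random element raises the mean of (N s_h − r a_h)² by at
-- most N², so |N s_h − r a_h| is of order N √n by c y ≤ y² + c² with c ≈ N √n. Charging the last n^(3/4) steps O(1) each
-- and every earlier step O(√n / n^(3/4)), the two strategies differ by O(n^(3/4)).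
module Submission where

open import Defs
open import Data.Nat using (ℕ; _≤_; _<_; _*_; _^_; _∸_; ∣_-_∣; _!)
open import Data.Product using (Σ; _×_)
open import Data.Nat using (zero; suc; pred; _+_; _⊓_; z≤n; s≤s; s≤s⁻¹; NonZero)
open import Data.Nat.Properties
open import Algebra.Properties.CommutativeSemigroup +-commutativeSemigroup using (interchange; x∙yz≈y∙xz)
open import Algebra.Properties.CommutativeSemigroup *-commutativeSemigroup using () renaming (interchange to interchange-*; x∙yz≈y∙xz to x∙yz≈y∙xz-*)
open import Data.Nat.Tactic.RingSolver using (solve-∀)
open import Data.Nat.ListAction using (sum)
open import Data.Nat.ListAction.Properties using (sum-++)
open import Data.Fin using (Fin; zero; suc; splitAt)
open import Data.List as List using (List; []; _∷_; _++_; concatMap)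
import Data.List.Properties as List
open import Data.Vec as Vec using (Vec; []; _∷_; lookup; tabulate; zipWith; toList; fromList)
open import Data.Vec.Properties using (lookup-zipWith; lookup∘tabulate; tabulate∘lookup; tabulate-cong; lookup-replicate; toList∘fromList)
open import Data.Product using (_,_; proj₁; proj₂)
open import Data.Sum using (_⊎_; inj₁; inj₂)
open import Function using (_∘_; _∋_; it)
open import Relation.Nullary using (contradiction)
open import Relation.Binary.PropositionalEquality using (_≡_; _≗_; refl; sym; trans; cong; cong₂; subst; subst₂)

private
  variable
    A B : Set
    m n : ℕ

-- Finite sums

∑ : (Fin m → ℕ) → ℕ
∑ f = Vec.sum (tabulate f)

∑-cong : {f g : Fin m → ℕ} → f ≗ g → ∑ f ≡ ∑ g
∑-cong f≗g = cong Vec.sum (tabulate-cong f≗g)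

∑-mono : {f g : Fin m → ℕ} → (∀ i → f i ≤ g i) → ∑ f ≤ ∑ g
∑-mono {zero} f≤g = z≤n
∑-mono {suc m} f≤g = +-mono-≤ (f≤g zero) (∑-mono (f≤g ∘ suc))

∑-+ : (f g : Fin m → ℕ) → ∑ (λ i → f i + g i) ≡ ∑ f + ∑ g
∑-+ {zero} f g = refl
∑-+ {suc m} f g = begin-equality
  f zero + g zero + ∑ (λ i → f (suc i) + g (suc i)) ≡⟨ cong (f zero + g zero +_) (∑-+ (f ∘ suc) (g ∘ suc)) ⟩
  f zero + g zero + (∑ (f ∘ suc) + ∑ (g ∘ suc))     ≡⟨ interchange (f zero) (g zero) _ _ ⟩
  f zero + ∑ (f ∘ suc) + (g zero + ∑ (g ∘ suc))     ∎
  where open ≤-Reasoning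

∑-*ˡ : ∀ c (f : Fin m → ℕ) → ∑ (λ i → c * f i) ≡ c * ∑ f
∑-*ˡ {zero} c f = sym (*-zeroʳ c)
∑-*ˡ {suc m} c f = trans (cong (c * f zero +_) (∑-*ˡ c (f ∘ suc))) (sym (*-distribˡ-+ c (f zero) _))

∑-const : ∀ c → ∑ {m} (λ _ → c) ≡ m * c
∑-const {zero} c = refl
∑-const {suc m} c = cong (c +_) (∑-const {m} c)

∑-zero : {f : Fin m → ℕ} → (∀ i → f i ≡ 0) → ∑ f ≡ 0
∑-zero {m} f≡0 = trans (∑-cong f≡0) (trans (∑-const {m} 0) (*-zeroʳ m))

-- Sums over the ways to remove one element, and over all arrangements

-- Positions rather than values are removed, so equal entries are counted separately. Divided by
-- `suc n`, this is the expectation over a uniform draw without replacement.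
sumRemove : (A → Vec A n → ℕ) → Vec A (suc n) → ℕ
sumRemove {n = zero} f (x ∷ []) = f x []
sumRemove {n = suc n} f (x ∷ xs) = f x xs + sumRemove (λ y ys → f y (x ∷ ys)) xs

data Removal {A : Set} : ∀ {n} → A → Vec A n → Vec A (suc n) → Set where
  here  : ∀ {n x} {v : Vec A n} → Removal x v (x ∷ v)
  there : ∀ {n x y} {v : Vec A n} {w} → Removal x v w → Removal x (y ∷ v) (y ∷ w)

sumRemove-mono : {f g : A → Vec A n → ℕ} (v : Vec A (suc n)) →
  (∀ {x w} → Removal x w v → f x w ≤ g x w) → sumRemove f v ≤ sumRemove g v
sumRemove-mono {n = zero} (x ∷ []) f≤g = f≤g here
sumRemove-mono {n = suc n} (x ∷ v) f≤g = +-mono-≤ (f≤g here) (sumRemove-mono v (f≤g ∘ there))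

sumRemove-cong : {f g : A → Vec A n → ℕ} (v : Vec A (suc n)) →
  (∀ {x w} → Removal x w v → f x w ≡ g x w) → sumRemove f v ≡ sumRemove g v
sumRemove-cong v f≡g =
  ≤-antisym (sumRemove-mono v (≤-reflexive ∘ f≡g)) (sumRemove-mono v (≤-reflexive ∘ sym ∘ f≡g))

sumRemove-+ : ∀ (f g : A → Vec A n → ℕ) v →
  sumRemove (λ x w → f x w + g x w) v ≡ sumRemove f v + sumRemove g v
sumRemove-+ {n = zero} f g (x ∷ []) = refl
sumRemove-+ {n = suc n} f g (x ∷ v) = trans
  (cong (f x v + g x v +_) (sumRemove-+ (λ y w → f y (x ∷ w)) (λ y w → g y (x ∷ w)) v))
  (interchange (f x v) (g x v) _ _)

sumRemove-*ˡ : ∀ c (f : A → Vec A n → ℕ) v → sumRemove (λ x w → c * f x w) v ≡ c * sumRemove f v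
sumRemove-*ˡ {n = zero} c f (x ∷ []) = refl
sumRemove-*ˡ {n = suc n} c f (x ∷ v) = trans
  (cong (c * f x v +_) (sumRemove-*ˡ c (λ y w → f y (x ∷ w)) v))
  (sym (*-distribˡ-+ c (f x v) _))

sumRemove-const : ∀ c (v : Vec A (suc n)) → sumRemove (λ _ _ → c) v ≡ suc n * c
sumRemove-const {n = zero} c (x ∷ []) = sym (+-identityʳ c)
sumRemove-const {n = suc n} c (x ∷ v) = cong (c +_) (sumRemove-const c v)

sumRemove-∑ : ∀ (f : A → Vec A n → Fin m → ℕ) v →
  sumRemove (λ x w → ∑ (f x w)) v ≡ ∑ (λ i → sumRemove (λ x w → f x w i) v)
sumRemove-∑ {n = zero} f (x ∷ []) = refl
sumRemove-∑ {n = suc n} f (x ∷ v) = trans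
  (cong (∑ (f x v) +_) (sumRemove-∑ (λ y w → f y (x ∷ w)) v))
  (sym (∑-+ (f x v) _))

sumRemove-element : ∀ (f : A → ℕ) (v : Vec A (suc n)) →
  sumRemove (λ x _ → f x) v ≡ sum (List.map f (toList v))
sumRemove-element {n = zero} f (x ∷ []) = sym (+-identityʳ (f x))
sumRemove-element {n = suc n} f (x ∷ v) = cong (f x +_) (sumRemove-element f v)

sumRemove-map : ∀ (g : A → B) (f : B → Vec B n → ℕ) v →
  sumRemove (λ x w → f (g x) (Vec.map g w)) v ≡ sumRemove f (Vec.map g v)
sumRemove-map {n = zero} g f (x ∷ []) = refl
sumRemove-map {n = suc n} g f (x ∷ v) =
  cong (f (g x) (Vec.map g v) +_) (sumRemove-map g (λ y w → f y (g x ∷ w)) v)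

-- This is n! times the mean over a uniformly random order. Drawing the front element first matches
-- the way a strategy consumes its input.
sumPerm : (List A → ℕ) → Vec A n → ℕ
sumPerm {n = zero} f v = f []
sumPerm {n = suc n} f v = sumRemove (λ x w → sumPerm (f ∘ (x ∷_)) w) v

data Arrangement {A : Set} : ∀ {n} → List A → Vec A n → Set where
  []  : Arrangement [] []
  _∷_ : ∀ {n x l} {v : Vec A n} {w} → Removal x v w → Arrangement l v → Arrangement (x ∷ l) w

sumPerm-mono : {f g : List A → ℕ} (v : Vec A n) →
  (∀ {l} → Arrangement l v → f l ≤ g l) → sumPerm f v ≤ sumPerm g v
sumPerm-mono {n = zero} [] f≤g = f≤g []
sumPerm-mono {n = suc n} v f≤g = sumRemove-mono v λ {x} {w} r → sumPerm-mono w λ arr → f≤g (r ∷ arr)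

sumPerm-cong : {f g : List A → ℕ} (v : Vec A n) →
  (∀ {l} → Arrangement l v → f l ≡ g l) → sumPerm f v ≡ sumPerm g v
sumPerm-cong v f≡g =
  ≤-antisym (sumPerm-mono v (≤-reflexive ∘ f≡g)) (sumPerm-mono v (≤-reflexive ∘ sym ∘ f≡g))

sumPerm-+ : ∀ (f g : List A → ℕ) (v : Vec A n) → sumPerm (λ l → f l + g l) v ≡ sumPerm f v + sumPerm g v
sumPerm-+ {n = zero} f g v = refl
sumPerm-+ {n = suc n} f g v = trans
  (sumRemove-cong v λ {x} {w} _ → sumPerm-+ (f ∘ (x ∷_)) (g ∘ (x ∷_)) w)
  (sumRemove-+ (λ x w → sumPerm (f ∘ (x ∷_)) w) (λ x w → sumPerm (g ∘ (x ∷_)) w) v)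

sumPerm-const : ∀ c (v : Vec A n) → sumPerm (λ _ → c) v ≡ n ! * c
sumPerm-const {n = zero} c v = sym (+-identityʳ c)
sumPerm-const {n = suc n} c v = trans
  (sumRemove-cong v λ {x} {w} _ → sumPerm-const c w)
  (trans (sumRemove-const (n ! * c) v) (sym (*-assoc (suc n) (n !) c)))

sumPerm-map : ∀ (g : A → B) (f : List B → ℕ) (v : Vec A n) →
  sumPerm (f ∘ List.map g) v ≡ sumPerm f (Vec.map g v)
sumPerm-map {n = zero} g f v = refl
sumPerm-map {n = suc n} g f v = trans
  (sumRemove-cong v λ {x} {w} _ → sumPerm-map g (f ∘ (g x ∷_)) w)
  (sumRemove-map g (λ y w → sumPerm (f ∘ (y ∷_)) w) v)

-- `permutations` inserts the head into arrangements of the tail, whereas `sumPerm` chooses the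
-- front first. Either `x` stands in front, or some `y` does and `x` is inserted behind it, which is
-- the induction hypothesis.
sumPerm-insertions : ∀ (f : List ℕ → ℕ) x (v : Vec ℕ n) →
  sumPerm f (x ∷ v) ≡ sumPerm (λ l → sum (List.map f (insertions x l))) v
sumPerm-insertions {zero} f x [] = sym (+-identityʳ _)
sumPerm-insertions {suc n} f x v = begin-equality
  sumPerm (f ∘ (x ∷_)) v + sumRemove (λ y w → sumPerm (f ∘ (y ∷_)) (x ∷ w)) v
    ≡⟨ cong (sumPerm (f ∘ (x ∷_)) v +_) (sumRemove-cong v λ {y} {w} _ → sumPerm-insertions (f ∘ (y ∷_)) x w) ⟩
  sumPerm (f ∘ (x ∷_)) v + sumRemove (λ y w → sumPerm (λ l → sum (List.map (f ∘ (y ∷_)) (insertions x l))) w) v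
    ≡⟨ sumRemove-+ (λ y w → sumPerm (f ∘ (x ∷_) ∘ (y ∷_)) w) _ v ⟨
  sumRemove (λ y w → sumPerm (f ∘ (x ∷_) ∘ (y ∷_)) w + sumPerm (λ l → sum (List.map (f ∘ (y ∷_)) (insertions x l))) w) v
    ≡⟨ sumRemove-cong v (λ {y} {w} _ → trans
         (sym (sumPerm-+ (f ∘ (x ∷_) ∘ (y ∷_)) _ w))
         (sumPerm-cong w λ {l} _ → cong (λ s → f (x ∷ y ∷ l) + sum s) (List.map-∘ (insertions x l)))) ⟩
  sumPerm (λ l → sum (List.map f (insertions x l))) v ∎
  where open ≤-Reasoning

sum-map-concatMap : ∀ (f : B → ℕ) (g : A → List B) xs →
  sum (List.map f (concatMap g xs)) ≡ sum (List.map (λ x → sum (List.map f (g x))) xs)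
sum-map-concatMap f g [] = refl
sum-map-concatMap f g (x ∷ xs) = begin-equality
  sum (List.map f (g x ++ concatMap g xs))                     ≡⟨ cong sum (List.map-++ f (g x) _) ⟩
  sum (List.map f (g x) ++ List.map f (concatMap g xs))        ≡⟨ sum-++ (List.map f (g x)) _ ⟩
  sum (List.map f (g x)) + sum (List.map f (concatMap g xs))   ≡⟨ cong (sum (List.map f (g x)) +_) (sum-map-concatMap f g xs) ⟩
  sum (List.map f (g x)) + sum (List.map (λ x → sum (List.map f (g x))) xs) ∎
  where open ≤-Reasoning

sum-permutations : ∀ (f : List ℕ → ℕ) (v : Vec ℕ n) →
  sum (List.map f (permutations (toList v))) ≡ sumPerm f v
sum-permutations f [] = +-identityʳ _
sum-permutations f (x ∷ v) = begin-equality
  sum (List.map f (concatMap (insertions x) (permutations (toList v))))  ≡⟨ sum-map-concatMap f (insertions x) (permutations (toList v)) ⟩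
  sum (List.map _ (permutations (toList v)))                             ≡⟨ sum-permutations _ v ⟩
  sumPerm (λ l → sum (List.map f (insertions x l))) v                    ≡⟨ sumPerm-insertions f x v ⟨
  sumPerm f (x ∷ v)                                                      ∎
  where open ≤-Reasoning

-- Conditioning on the first `j` entries, later the pivots: a bound with the same `b` for each
-- prefix survives summation, and the choices of the prefix turn the factor `r !` into `(j + r) !`.
sumPerm-prefix-≤ : ∀ j {r} (f g : List A → ℕ) b →
  (∀ (ps : Vec A j) (w : Vec A r) →
    sumPerm (λ l → f (toList ps ++ l)) w ≤ sumPerm (λ l → g (toList ps ++ l)) w + r ! * b) →
  (v : Vec A (j + r)) → sumPerm f v ≤ sumPerm g v + (j + r) ! * b
sumPerm-prefix-≤ zero f g b bound v = bound [] v
sumPerm-prefix-≤ (suc j) {r} f g b bound v = begin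
  sumPerm f v
    ≤⟨ sumRemove-mono v (λ {x} {w} _ → sumPerm-prefix-≤ j (f ∘ (x ∷_)) (g ∘ (x ∷_)) b (λ ps → bound (x ∷ ps)) w) ⟩
  sumRemove (λ x w → sumPerm (g ∘ (x ∷_)) w + (j + r) ! * b) v
    ≡⟨ sumRemove-+ (λ x w → sumPerm (g ∘ (x ∷_)) w) _ v ⟩
  sumPerm g v + sumRemove (λ _ _ → (j + r) ! * b) v
    ≡⟨ cong (sumPerm g v +_) (trans (sumRemove-const _ v) (sym (*-assoc (suc (j + r)) ((j + r) !) b))) ⟩
  sumPerm g v + (suc j + r) ! * b ∎
  where open ≤-Reasoning

-- Counts, costs and strategies

kronecker : Fin m → Fin m → ℕ
kronecker zero zero = 1
kronecker zero (suc _) = 0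
kronecker (suc _) zero = 0
kronecker (suc g) (suc i) = kronecker g i

kronecker-01 : (g i : Fin m) → kronecker g i ≡ 0 ⊎ kronecker g i ≡ 1
kronecker-01 zero zero = inj₂ refl
kronecker-01 zero (suc _) = inj₁ refl
kronecker-01 (suc _) zero = inj₁ refl
kronecker-01 (suc g) (suc i) = kronecker-01 g i

∑-kronecker : ∀ (f : Fin m → ℕ) g → ∑ (λ i → f i * kronecker g i) ≡ f g
∑-kronecker f zero = trans
  (cong₂ _+_ (*-identityʳ (f zero)) (∑-zero λ i → *-zeroʳ (f (suc i)))) (+-identityʳ (f zero))
∑-kronecker f (suc g) = cong₂ _+_ (*-zeroʳ (f zero)) (∑-kronecker (f ∘ suc) g)

-- `counts` increments through a function local to its definition; unification is the only way to name it.
increment : (g : Fin m) (gs : List (Fin m)) →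
  Σ (Fin m → ℕ) λ f → counts (g ∷ gs) ≡ zipWith _+_ (tabulate f) (counts gs)
increment g gs = _ , refl

increment-kronecker : ∀ (g i : Fin m) gs → proj₁ (increment g gs) i ≡ kronecker g i
increment-kronecker zero zero gs = refl
increment-kronecker zero (suc i) gs = refl
increment-kronecker (suc g) zero gs = refl
-- The local function ignores the enclosing list, so any list serves in the recursive call.
increment-kronecker (suc g) (suc i) gs = increment-kronecker g i []

count : List (Fin m) → Fin m → ℕ
count gs i = lookup (counts gs) i

count-∷ : ∀ (g : Fin m) gs i → count (g ∷ gs) i ≡ kronecker g i + count gs i
count-∷ g gs i = begin-equality
  count (g ∷ gs) i                                      ≡⟨ lookup-zipWith _+_ i (tabulate (proj₁ (increment g gs))) (counts gs) ⟩
  lookup (tabulate (proj₁ (increment g gs))) i + count gs i ≡⟨ cong (_+ count gs i) (lookup∘tabulate _ i) ⟩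
  proj₁ (increment g gs) i + count gs i                 ≡⟨ cong (_+ count gs i) (increment-kronecker g i gs) ⟩
  kronecker g i + count gs i                            ∎
  where open ≤-Reasoning

count-sum : ∀ (gs : List (Fin m)) i → count gs i ≡ sum (List.map (λ g → kronecker g i) gs)
count-sum [] i = lookup-replicate i 0
count-sum (g ∷ gs) i = trans (count-∷ g gs i) (cong (kronecker g i +_) (count-sum gs i))

count-removal : ∀ {x} {w : Vec (Fin m) n} {v} → Removal x w v → ∀ i →
  count (toList v) i ≡ kronecker x i + count (toList w) i
count-removal {x = x} {w} here i = count-∷ x (toList w) i
count-removal {x = x} (there {y = y} {v = w} {w = v} rem) i = begin-equality
  count (y ∷ toList v) i                                    ≡⟨ count-∷ y (toList v) i ⟩
  kronecker y i + count (toList v) i                        ≡⟨ cong (kronecker y i +_) (count-removal rem i) ⟩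
  kronecker y i + (kronecker x i + count (toList w) i)      ≡⟨ x∙yz≈y∙xz (kronecker y i) (kronecker x i) _ ⟩
  kronecker x i + (kronecker y i + count (toList w) i)      ≡⟨ cong (kronecker x i +_) (count-∷ y (toList w) i) ⟨
  kronecker x i + count (y ∷ toList w) i                    ∎
  where open ≤-Reasoning

-- Once the pivots are fixed, this makes the group sizes, and with them the tree chosen by the
-- fixed-tree strategy, the same for every order of the non-pivots.
count-arrangement : ∀ {l} {v : Vec (Fin m) n} → Arrangement l v → ∀ i → count l i ≡ count (toList v) i
count-arrangement [] i = refl
count-arrangement (_∷_ {x = x} {l} rem arr) i = trans (count-∷ x l i)
  (trans (cong (kronecker x i +_) (count-arrangement arr i)) (sym (count-removal rem i)))

lookup-ext : {u w : Vec ℕ m} → (∀ i → lookup u i ≡ lookup w i) → u ≡ w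
lookup-ext {u = u} {w} eq = trans (sym (tabulate∘lookup u)) (trans (tabulate-cong eq) (tabulate∘lookup w))

cost-counts : ∀ (t : Tree m) gs → cost t (counts gs) ≡ sum (List.map (depth t) gs)
cost-counts t [] = ∑-zero λ i → trans (cong (depth t i *_) (lookup-replicate i 0)) (*-zeroʳ (depth t i))
cost-counts t (g ∷ gs) = begin-equality
  ∑ (λ i → depth t i * count (g ∷ gs) i)
    ≡⟨ ∑-cong (λ i → trans (cong (depth t i *_) (count-∷ g gs i)) (*-distribˡ-+ (depth t i) _ _)) ⟩
  ∑ (λ i → depth t i * kronecker g i + depth t i * count gs i)
    ≡⟨ ∑-+ (λ i → depth t i * kronecker g i) _ ⟩
  ∑ (λ i → depth t i * kronecker g i) + cost t (counts gs)
    ≡⟨ cong₂ _+_ (∑-kronecker (depth t) g) (cost-counts t gs) ⟩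
  depth t g + sum (List.map (depth t) gs) ∎
  where open ≤-Reasoning

-- Each step downward leaves behind a sibling subtree with at least one leaf, which pays for that
-- comparison.
depth-≤ : ∀ (t : Tree m) i → depth t i ≤ m
depth-≤ leaf i = z≤n
depth-≤ (node {a} {b} l r) i with splitAt (suc a) i
... | inj₁ j = ≤-trans (s≤s (depth-≤ l j)) (≤-trans (≤-reflexive (+-comm 1 (suc a))) (+-monoʳ-≤ (suc a) (s≤s z≤n)))
... | inj₂ j = s≤s (≤-trans (depth-≤ r j) (m≤n+m (suc b) a))

sum-map-≤ : ∀ (f : A → ℕ) {c} → (∀ x → f x ≤ c) → (v : Vec A n) → sum (List.map f (toList v)) ≤ n * c
sum-map-≤ f f≤c [] = z≤n
sum-map-≤ f f≤c (x ∷ v) = +-mono-≤ (f≤c x) (sum-map-≤ f f≤c v)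

run : (List (Fin m) → Tree m) → List (Fin m) → List (Fin m) → ℕ
run t hist [] = 0
run t hist (g ∷ gs) = depth (t hist) g + run t (g ∷ hist) gs

-- As for `increment`: `go` is the local function in the definition of `costO`, recovered by unification.
mutual
  go : ∀ k → SelectorO k → List ℕ → List (Fin (suc k)) → List (Fin (suc k)) → ℕ
  go k sel e hist gs = _

  costO-go : ∀ k (sel : SelectorO k) e → costO k sel e ≡ go k sel e [] (groupSeq k e)
  -- Abstracting both list arguments into variables forces the unifier to find `go` at general
  -- arguments, as the induction in `go-run` needs.
  costO-go k sel e with groupSeq k e | (List (Fin (suc k)) ∋ [])
  ... | gs | hist = refl {x = go k sel e hist gs}

go-run : ∀ k (sel : SelectorO k) e hist gs →
  go k sel e hist gs ≡ run (λ h → proj₁ (sel (sizes k e) h)) hist gs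
go-run k sel e hist [] = refl
go-run k sel e hist (g ∷ gs) = cong (_ +_) (go-run k sel e (g ∷ hist) gs)

costO-run : ∀ k (sel : SelectorO k) e →
  costO k sel e ≡ run (λ h → proj₁ (sel (sizes k e) h)) [] (groupSeq k e)
costO-run k sel e = trans (costO-go k sel e) (go-run k sel e [] (groupSeq k e))

-- Hypergeometric fluctuations

square : ℕ → ℕ
square n = n * n

-- The expansion of (p - q)² without subtraction: adding the cross term removes absolute values from
-- identities over ℕ.
∣-∣-square : ∀ p q → square ∣ p - q ∣ + 2 * (p * q) ≡ square p + square q
∣-∣-square p q with ≤-total p q
... | inj₁ p≤q = subst (λ q → square ∣ p - q ∣ + 2 * (p * q) ≡ square p + square q) (m+[n∸m]≡n p≤q)
  (trans (cong (λ d → square d + 2 * (p * (p + (q ∸ p)))) (∣m-m+n∣≡n p (q ∸ p))) (expand p (q ∸ p)))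
  where
  expand : ∀ p d → d * d + 2 * (p * (p + d)) ≡ p * p + (p + d) * (p + d)
  expand = solve-∀
... | inj₂ q≤p = subst (λ p → square ∣ p - q ∣ + 2 * (p * q) ≡ square p + square q) (m+[n∸m]≡n q≤p)
  (trans (cong (λ d → square d + 2 * ((q + (p ∸ q)) * q)) (trans (∣-∣-comm (q + (p ∸ q)) q) (∣m-m+n∣≡n q (p ∸ q))))
    (expand q (p ∸ q)))
  where
  expand : ∀ q d → d * d + 2 * ((q + d) * q) ≡ (q + d) * (q + d) + q * q
  expand = solve-∀

-- The one-step evolution of the squared deviation y² with y = N s − r α: among the r = s + w elements, removing
-- one of the s counted ones changes y to y + α − N, removing another one changes it to y + α.
deviation-identity : ∀ N α s w n → s + w ≡ suc n →
  s * square ∣ N * pred s - n * α ∣ + suc w * square ∣ N * s - n * α ∣ + n * square α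
    ≡ n * square ∣ N * s - suc n * α ∣ + N * N * s
-- The truncation `pred 0 = 0` is harmless here, since its term has coefficient 0.
deviation-identity N α zero .(suc n) n refl rewrite *-zeroʳ N = polynomial N α n
  where
  polynomial : ∀ N α n → suc (suc n) * (n * α * (n * α)) + n * (α * α) ≡ n * (suc n * α * (suc n * α)) + N * N * 0
  polynomial = solve-∀
-- Adding the cross terms of all three squares to both sides makes every absolute value expandable;
-- what remains is a polynomial identity.
deviation-identity N α (suc s) w .(s + w) refl = +-cancelʳ-≡ (suc s * X₁ + suc w * X₀ + (s + w) * X) _ _ (begin-equality
  suc s * Q₁ + suc w * Q₀ + (s + w) * square α + (suc s * X₁ + suc w * X₀ + (s + w) * X)
    ≡⟨ collect s w (square α) Q₁ Q₀ X₁ X₀ X ⟩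
  suc s * (Q₁ + X₁) + suc w * (Q₀ + X₀) + (s + w) * square α + (s + w) * X
    ≡⟨ cong₂ (λ z z' → suc s * z + suc w * z' + (s + w) * square α + (s + w) * X)
         (∣-∣-square (N * s) ((s + w) * α)) (∣-∣-square (N * suc s) ((s + w) * α)) ⟩
  suc s * (square (N * s) + square ((s + w) * α)) + suc w * (square (N * suc s) + square ((s + w) * α))
    + (s + w) * square α + (s + w) * X
    ≡⟨ polynomial N α s w ⟩
  (s + w) * (square (N * suc s) + square (suc (s + w) * α)) + N * N * suc s + (suc s * X₁ + suc w * X₀)
    ≡⟨ cong (λ z → (s + w) * z + N * N * suc s + (suc s * X₁ + suc w * X₀)) (∣-∣-square (N * suc s) (suc (s + w) * α)) ⟨
  (s + w) * (Y + X) + N * N * suc s + (suc s * X₁ + suc w * X₀)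
    ≡⟨ distribute (s + w) Y X (N * N * suc s) (suc s * X₁ + suc w * X₀) ⟩
  (s + w) * Y + N * N * suc s + (suc s * X₁ + suc w * X₀ + (s + w) * X) ∎)
  where
  open ≤-Reasoning
  Q₁ = square ∣ N * s - (s + w) * α ∣
  Q₀ = square ∣ N * suc s - (s + w) * α ∣
  Y  = square ∣ N * suc s - suc (s + w) * α ∣
  X₁ = 2 * (N * s * ((s + w) * α))
  X₀ = 2 * (N * suc s * ((s + w) * α))
  X  = 2 * (N * suc s * (suc (s + w) * α))
  collect : ∀ s w b Q₁ Q₀ X₁ X₀ X →
    suc s * Q₁ + suc w * Q₀ + (s + w) * b + (suc s * X₁ + suc w * X₀ + (s + w) * X)
      ≡ suc s * (Q₁ + X₁) + suc w * (Q₀ + X₀) + (s + w) * b + (s + w) * X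
  collect = solve-∀
  polynomial : ∀ N α s w →
    suc s * (N * s * (N * s) + (s + w) * α * ((s + w) * α)) + suc w * (N * suc s * (N * suc s) + (s + w) * α * ((s + w) * α))
      + (s + w) * (α * α) + (s + w) * (2 * (N * suc s * (suc (s + w) * α)))
    ≡ (s + w) * (N * suc s * (N * suc s) + suc (s + w) * α * (suc (s + w) * α)) + N * N * suc s
      + (suc s * (2 * (N * s * ((s + w) * α))) + suc w * (2 * (N * suc s * ((s + w) * α))))
  polynomial = solve-∀
  distribute : ∀ r Y X P Z → r * (Y + X) + P + Z ≡ r * Y + P + (Z + r * X)
  distribute = solve-∀

-- The value of `ψ` after a removal is a combination, with coefficients `ψ (pred s)` and `ψ s`, of
-- the indicator of group `i` and its complement, so linearity applies. The complementary count `w`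
-- is given by an equation to avoid subtraction.
sumRemove-count : ∀ (ψ : ℕ → ℕ) i (v : Vec (Fin m) (suc n)) → let s = count (toList v) i in
  Σ ℕ λ w → s + w ≡ suc n × sumRemove (λ _ u → ψ (count (toList u) i)) v ≡ s * ψ (pred s) + w * ψ s
sumRemove-count {n = n} ψ i v = w , total , split
  where
  open ≤-Reasoning
  s = count (toList v) i
  w = sumRemove (λ x _ → 1 ∸ kronecker x i) v
  s-sum : sumRemove (λ x _ → kronecker x i) v ≡ s
  s-sum = trans (sumRemove-element (λ x → kronecker x i) v) (sym (count-sum (toList v) i))
  kronecker-compl : ∀ x → kronecker x i + (1 ∸ kronecker x i) ≡ 1
  kronecker-compl x with kronecker-01 x i
  ... | inj₁ eq rewrite eq = refl
  ... | inj₂ eq rewrite eq = refl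
  total : s + w ≡ suc n
  total = begin-equality
    s + w                                                            ≡⟨ cong (_+ w) s-sum ⟨
    sumRemove (λ x _ → kronecker x i) v + w                          ≡⟨ sumRemove-+ (λ x _ → kronecker x i) _ v ⟨
    sumRemove (λ x _ → kronecker x i + (1 ∸ kronecker x i)) v        ≡⟨ sumRemove-cong v (λ {x} _ → kronecker-compl x) ⟩
    sumRemove (λ _ _ → 1) v                                          ≡⟨ sumRemove-const 1 v ⟩
    suc n * 1                                                        ≡⟨ *-identityʳ (suc n) ⟩
    suc n                                                            ∎
  cases : ∀ {x u} → Removal x u v →
    ψ (count (toList u) i) ≡ ψ (pred s) * kronecker x i + ψ s * (1 ∸ kronecker x i)
  cases {x} {u} rem with kronecker-01 x i | count-removal rem i
  ... | inj₁ eq | s≡ rewrite eq | s≡ = sym (cong₂ _+_ (*-zeroʳ (ψ (pred (count (toList u) i)))) (*-identityʳ _))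
  ... | inj₂ eq | s≡ rewrite eq | s≡ = sym (trans (cong₂ _+_ (*-identityʳ _) (*-zeroʳ (ψ (suc (count (toList u) i))))) (+-identityʳ _))
  split : sumRemove (λ _ u → ψ (count (toList u) i)) v ≡ s * ψ (pred s) + w * ψ s
  split = begin-equality
    sumRemove (λ _ u → ψ (count (toList u) i)) v
      ≡⟨ sumRemove-cong v cases ⟩
    sumRemove (λ x _ → ψ (pred s) * kronecker x i + ψ s * (1 ∸ kronecker x i)) v
      ≡⟨ sumRemove-+ (λ x _ → ψ (pred s) * kronecker x i) _ v ⟩
    sumRemove (λ x _ → ψ (pred s) * kronecker x i) v + sumRemove (λ x _ → ψ s * (1 ∸ kronecker x i)) v
      ≡⟨ cong₂ _+_ (sumRemove-*ˡ (ψ (pred s)) (λ x _ → kronecker x i) v) (sumRemove-*ˡ (ψ s) (λ x _ → 1 ∸ kronecker x i) v) ⟩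
    ψ (pred s) * sumRemove (λ x _ → kronecker x i) v + ψ s * w
      ≡⟨ cong₂ _+_ (trans (cong (ψ (pred s) *_) s-sum) (*-comm (ψ (pred s)) s)) (*-comm (ψ s) w) ⟩
    s * ψ (pred s) + w * ψ s ∎

-- The sum over removals, increased by one more `Q₀` and by `n * square α`, completes a square and
-- equals `n * Y + N * N * s`. Both additions are nonnegative and `s` is at most `suc n`.
sumRemove-deviation : ∀ N α i (v : Vec (Fin m) (suc n)) →
  sumRemove (λ _ u → square ∣ N * count (toList u) i - n * α ∣) v
    ≤ suc n * (square ∣ N * count (toList v) i - suc n * α ∣ + N * N)
sumRemove-deviation {n = n} N α i v with sumRemove-count (λ s → square ∣ N * s - n * α ∣) i v
... | w , total , split = begin
  sumRemove (λ _ u → square ∣ N * count (toList u) i - n * α ∣) v  ≡⟨ split ⟩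
  s * Q₁ + w * Q₀                                                  ≤⟨ +-monoʳ-≤ (s * Q₁) (m≤n+m (w * Q₀) Q₀) ⟩
  s * Q₁ + suc w * Q₀                                              ≤⟨ m≤m+n _ (n * square α) ⟩
  s * Q₁ + suc w * Q₀ + n * square α                               ≡⟨ deviation-identity N α s w n total ⟩
  n * Y + N * N * s                                                ≤⟨ +-mono-≤ (m≤n+m (n * Y) Y) (*-monoʳ-≤ (N * N) s≤) ⟩
  suc n * Y + N * N * suc n                                        ≡⟨ cong (suc n * Y +_) (*-comm (N * N) (suc n)) ⟩
  suc n * Y + suc n * (N * N)                                      ≡⟨ *-distribˡ-+ (suc n) Y (N * N) ⟨
  suc n * (Y + N * N)                                              ∎
  where
  open ≤-Reasoning
  s  = count (toList v) i
  Q₁ = square ∣ N * pred s - n * α ∣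
  Q₀ = square ∣ N * s - n * α ∣
  Y  = square ∣ N * s - suc n * α ∣
  s≤ : s ≤ suc n
  s≤ = ≤-trans (m≤m+n s w) (≤-reflexive total)

-- Comparison of the two strategies

-- Coordinatewise, the first scaled vector exceeds the second by at most their distance, weighted by
-- a depth of at most `m`. It serves to transfer costs both from current counts to initial sizes and
-- back.
cost-deviation : ∀ (t : Tree m) u w p q →
  p * cost t u ≤ q * cost t w + m * ∑ (λ i → ∣ p * lookup u i - q * lookup w i ∣)
cost-deviation {m} t u w p q = begin
  p * cost t u                                                ≡⟨ ∑-*ˡ p (λ i → depth t i * lookup u i) ⟨
  ∑ (λ i → p * (depth t i * lookup u i))                      ≤⟨ ∑-mono pointwise ⟩
  ∑ (λ i → q * (depth t i * lookup w i) + m * dev i)          ≡⟨ ∑-+ (λ i → q * (depth t i * lookup w i)) _ ⟩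
  ∑ (λ i → q * (depth t i * lookup w i)) + ∑ (λ i → m * dev i) ≡⟨ cong₂ _+_ (∑-*ˡ q (λ i → depth t i * lookup w i)) (∑-*ˡ m dev) ⟩
  q * cost t w + m * ∑ dev                                    ∎
  where
  open ≤-Reasoning
  dev : Fin m → ℕ
  dev i = ∣ p * lookup u i - q * lookup w i ∣
  pointwise : ∀ i → p * (depth t i * lookup u i) ≤ q * (depth t i * lookup w i) + m * dev i
  pointwise i = begin
    p * (depth t i * lookup u i)                   ≡⟨ x∙yz≈y∙xz-* p (depth t i) (lookup u i) ⟩
    depth t i * (p * lookup u i)                   ≤⟨ *-monoʳ-≤ (depth t i) (m≤n+∣m-n∣ (p * lookup u i) (q * lookup w i)) ⟩
    depth t i * (q * lookup w i + dev i)           ≡⟨ *-distribˡ-+ (depth t i) (q * lookup w i) (dev i) ⟩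
    depth t i * (q * lookup w i) + depth t i * dev i ≤⟨ +-mono-≤ (≤-reflexive (x∙yz≈y∙xz-* (depth t i) q (lookup w i))) (*-monoˡ-≤ (dev i) (depth-≤ t i)) ⟩
    q * (depth t i * lookup w i) + m * dev i       ∎

-- The product is at most the larger square. This bounds first absolute moments by second moments
-- without square roots.
x*y≤y*y+x*x : ∀ x y → x * y ≤ y * y + x * x
x*y≤y*y+x*x x y with ≤-total x y
... | inj₁ x≤y = ≤-trans (*-monoˡ-≤ y x≤y) (m≤m+n (y * y) (x * x))
... | inj₂ y≤x = ≤-trans (*-monoʳ-≤ x y≤x) (m≤n+m (x * x) (y * y))

-- The tree is chosen before the element is drawn. Each element comes first in n! of the orders, so
-- the current step contributes n! times the cost of the remaining counts.
sumRemove-sumPerm-depth : ∀ (t : Tree m) (f : Fin m → List (Fin m) → ℕ) (v : Vec (Fin m) (suc n)) →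
  sumRemove (λ x u → sumPerm (λ l → depth t x + f x l) u) v
    ≡ n ! * cost t (counts (toList v)) + sumRemove (λ x u → sumPerm (f x) u) v
sumRemove-sumPerm-depth {n = n} t f v = begin-equality
  sumRemove (λ x u → sumPerm (λ l → depth t x + f x l) u) v
    ≡⟨ sumRemove-cong v (λ {x} {u} _ → trans (sumPerm-+ (λ _ → depth t x) (f x) u) (cong (_+ sumPerm (f x) u) (sumPerm-const (depth t x) u))) ⟩
  sumRemove (λ x u → n ! * depth t x + sumPerm (f x) u) v
    ≡⟨ sumRemove-+ (λ x _ → n ! * depth t x) _ v ⟩
  sumRemove (λ x _ → n ! * depth t x) v + rest
    ≡⟨ cong (_+ rest) (sumRemove-*ˡ (n !) (λ x _ → depth t x) v) ⟩
  n ! * sumRemove (λ x _ → depth t x) v + rest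
    ≡⟨ cong (λ z → n ! * z + rest) (trans (sumRemove-element (depth t) v) (sym (cost-counts t (toList v)))) ⟩
  n ! * cost t (counts (toList v)) + rest ∎
  where
  open ≤-Reasoning
  rest = sumRemove (λ x u → sumPerm (f x) u) v

-- `N` is the number of elements to classify and `a` holds the initial group sizes. `c` is the scale
-- in c y ≤ y² + c², and `M` is the number of final steps that are charged a constant each.
module Comparison {m : ℕ} (N : ℕ) (a : Vec ℕ m)
  (tN : Tree m) (tN-min : ∀ t → cost tN a ≤ cost t a)
  (tO : List (Fin m) → Tree m)
  (tO-min : ∀ hist t → cost (tO hist) (zipWith _∸_ a (counts hist)) ≤ cost t (zipWith _∸_ a (counts hist)))
  (c M : ℕ) where

  open ≤-Reasoning

  sumN : Vec (Fin m) n → ℕ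
  sumN v = sumPerm (λ l → sum (List.map (depth tN) l)) v

  sumO : List (Fin m) → Vec (Fin m) n → ℕ
  sumO hist v = sumPerm (run tO hist) v

  sumN-suc : (v : Vec (Fin m) (suc n)) →
    sumN v ≡ n ! * cost tN (counts (toList v)) + sumRemove (λ _ u → sumN u) v
  sumN-suc v = sumRemove-sumPerm-depth tN _ v

  sumO-suc : ∀ hist (v : Vec (Fin m) (suc n)) →
    sumO hist v ≡ n ! * cost (tO hist) (counts (toList v)) + sumRemove (λ x u → sumO (x ∷ hist) u) v
  sumO-suc hist v = sumRemove-sumPerm-depth (tO hist) _ v

  -- The invariant under which the truncated difference `zipWith _∸_ a (counts hist)` is the true
  -- vector of remaining counts, so that the choice of `tO` is optimal for the current step.
  Remaining : List (Fin m) → Vec (Fin m) n → Set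
  Remaining hist v = ∀ i → count hist i + count (toList v) i ≡ lookup a i

  remaining-removal : ∀ hist {x} {u : Vec (Fin m) n} {v} →
    Remaining hist v → Removal x u v → Remaining (x ∷ hist) u
  remaining-removal hist {x} {u} {v} rem r i = begin-equality
    count (x ∷ hist) i + count (toList u) i             ≡⟨ cong (_+ count (toList u) i) (count-∷ x hist i) ⟩
    kronecker x i + count hist i + count (toList u) i   ≡⟨ cong (_+ count (toList u) i) (+-comm (kronecker x i) (count hist i)) ⟩
    count hist i + kronecker x i + count (toList u) i   ≡⟨ +-assoc (count hist i) (kronecker x i) _ ⟩
    count hist i + (kronecker x i + count (toList u) i) ≡⟨ cong (count hist i +_) (count-removal r i) ⟨
    count hist i + count (toList v) i                   ≡⟨ rem i ⟩
    lookup a i                                          ∎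

  remaining-counts : ∀ hist (v : Vec (Fin m) n) → Remaining hist v →
    zipWith _∸_ a (counts hist) ≡ counts (toList v)
  remaining-counts hist v rem = lookup-ext λ i → begin-equality
    lookup (zipWith _∸_ a (counts hist)) i                ≡⟨ lookup-zipWith _∸_ i a (counts hist) ⟩
    lookup a i ∸ count hist i                             ≡⟨ cong (_∸ count hist i) (rem i) ⟨
    count hist i + count (toList v) i ∸ count hist i      ≡⟨ m+n∸m≡n (count hist i) _ ⟩
    count (toList v) i                                    ∎

  tO-optimal : ∀ hist (v : Vec (Fin m) n) → Remaining hist v →
    ∀ t → cost (tO hist) (counts (toList v)) ≤ cost t (counts (toList v))
  tO-optimal hist v rem t = subst (λ b → cost (tO hist) b ≤ cost t b) (remaining-counts hist v rem) (tO-min hist t)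

  -- At every step `tO` is at least as good as `tN` for the remaining counts, and both recursions
  -- then branch over the same draws.
  sumO≤sumN : ∀ hist (v : Vec (Fin m) n) → Remaining hist v → sumO hist v ≤ sumN v
  sumO≤sumN {zero} hist v rem = z≤n
  sumO≤sumN {suc n} hist v rem = begin
    sumO hist v
      ≡⟨ sumO-suc hist v ⟩
    n ! * cost (tO hist) (counts (toList v)) + sumRemove (λ x u → sumO (x ∷ hist) u) v
      ≤⟨ +-mono-≤ (*-monoʳ-≤ (n !) (tO-optimal hist v rem tN))
           (sumRemove-mono v λ {x} {u} r → sumO≤sumN (x ∷ hist) u (remaining-removal hist rem r)) ⟩
    n ! * cost tN (counts (toList v)) + sumRemove (λ _ u → sumN u) v
      ≡⟨ sumN-suc v ⟨
    sumN v ∎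

  -- The difference between the current and the initial proportion of group `i`, multiplied by
  -- `N * n` to stay integral.
  deviation : Vec (Fin m) n → Fin m → ℕ
  deviation {n} v i = ∣ N * count (toList v) i - n * lookup a i ∣

  variation : Vec (Fin m) n → ℕ
  variation v = ∑ (λ i → square (deviation v i))

  sumRemove-variation : (v : Vec (Fin m) (suc n)) →
    sumRemove (λ _ u → variation u) v ≤ suc n * (variation v + m * (N * N))
  sumRemove-variation {n} v = begin
    sumRemove (λ _ u → variation u) v
      ≡⟨ sumRemove-∑ (λ _ u i → square (deviation u i)) v ⟩
    ∑ (λ i → sumRemove (λ _ u → square (deviation u i)) v)
      ≤⟨ ∑-mono (λ i → sumRemove-deviation N (lookup a i) i v) ⟩
    ∑ (λ i → suc n * (square (deviation v i) + N * N))
      ≡⟨ ∑-*ˡ (suc n) (λ i → square (deviation v i) + N * N) ⟩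
    suc n * ∑ (λ i → square (deviation v i) + N * N)
      ≡⟨ cong (suc n *_) (trans (∑-+ (λ i → square (deviation v i)) (λ _ → N * N)) (cong (variation v +_) (∑-const {m} (N * N)))) ⟩
    suc n * (variation v + m * (N * N)) ∎

  -- Pass from the current counts to `a`, use optimality of `tN` there, and pass back with `t`. Each
  -- passage costs `m * Δ`, and `c * Δ` is bounded through second moments.
  tN-excess : ∀ (v : Vec (Fin m) n) t →
    c * (N * cost tN (counts (toList v)))
      ≤ c * (N * cost t (counts (toList v))) + 2 * m * (variation v + m * (c * c))
  tN-excess {n} v t = begin
    c * (N * cost tN b)
      ≤⟨ *-monoʳ-≤ c (cost-deviation tN b a N n) ⟩
    c * (n * cost tN a + m * Δ)
      ≤⟨ *-monoʳ-≤ c (+-monoˡ-≤ (m * Δ) (*-monoʳ-≤ n (tN-min t))) ⟩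
    c * (n * cost t a + m * Δ)
      ≤⟨ *-monoʳ-≤ c (+-monoˡ-≤ (m * Δ) (cost-deviation t a b n N)) ⟩
    c * (N * cost t b + m * ∑ (λ i → ∣ n * lookup a i - N * count (toList v) i ∣) + m * Δ)
      ≡⟨ cong (λ z → c * (N * cost t b + m * z + m * Δ)) (∑-cong λ i → ∣-∣-comm (n * lookup a i) (N * count (toList v) i)) ⟩
    c * (N * cost t b + m * Δ + m * Δ)
      ≡⟨ collect c (N * cost t b) m Δ ⟩
    c * (N * cost t b) + 2 * m * (c * Δ)
      ≤⟨ +-monoʳ-≤ (c * (N * cost t b)) (*-monoʳ-≤ (2 * m) cΔ≤) ⟩
    c * (N * cost t b) + 2 * m * (variation v + m * (c * c)) ∎
    where
    b = counts (toList v)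
    Δ = ∑ (deviation v)
    collect : ∀ c x m Δ → c * (x + m * Δ + m * Δ) ≡ c * x + 2 * m * (c * Δ)
    collect = solve-∀
    cΔ≤ : c * Δ ≤ variation v + m * (c * c)
    cΔ≤ = begin
      c * Δ                                            ≡⟨ ∑-*ˡ c (deviation v) ⟨
      ∑ (λ i → c * deviation v i)                      ≤⟨ ∑-mono (λ i → x*y≤y*y+x*x c (deviation v i)) ⟩
      ∑ (λ i → square (deviation v i) + c * c)         ≡⟨ ∑-+ (λ i → square (deviation v i)) (λ _ → c * c) ⟩
      variation v + ∑ {m} (λ _ → c * c)                ≡⟨ cong (variation v +_) (∑-const {m} (c * c)) ⟩
      variation v + m * (c * c)                        ∎

  -- A common denominator: `c` comes from the second-moment bound, `N` from the scaling of the
  -- deviations, and `M` is a lower bound for the number of remaining elements in the early steps.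
  weight : ℕ
  weight = c * N * M

  -- While `M ≤ n`, `tN-excess` applies and `M * n !` is absorbed by `suc n !`. Afterwards the whole
  -- step is charged at most `m` per order. The flag `j` marks the second regime, and its inequality
  -- makes the flags telescope to a total of at most `M`.
  step-excess : ∀ (v : Vec (Fin m) (suc n)) t → Σ ℕ λ j → (n ⊓ M + j ≤ suc n ⊓ M) ×
    weight * (n ! * cost tN (counts (toList v)))
      ≤ weight * (n ! * cost t (counts (toList v)))
        + suc n ! * (2 * m * (variation v + m * (c * c)) + weight * m * j)
  step-excess {n} v t with ≤-<-connex M n
  ... | inj₁ M≤n = 0 , ≤-trans (≤-reflexive (+-identityʳ (n ⊓ M))) (⊓-monoˡ-≤ M (n≤1+n n)) , (begin
    weight * (n ! * cost tN b)
      ≡⟨ regroup c N M (n !) (cost tN b) ⟩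
    M * n ! * (c * (N * cost tN b))
      ≤⟨ *-monoʳ-≤ (M * n !) (tN-excess v t) ⟩
    M * n ! * (c * (N * cost t b) + e)
      ≡⟨ *-distribˡ-+ (M * n !) (c * (N * cost t b)) e ⟩
    M * n ! * (c * (N * cost t b)) + M * n ! * e
      ≤⟨ +-mono-≤ (≤-reflexive (sym (regroup c N M (n !) (cost t b))))
           (*-mono-≤ (*-monoˡ-≤ (n !) (m≤n⇒m≤1+n M≤n)) (m≤m+n e (weight * m * 0))) ⟩
    weight * (n ! * cost t b) + suc n ! * (e + weight * m * 0) ∎)
    where
    b = counts (toList v)
    e = 2 * m * (variation v + m * (c * c))
    regroup : ∀ c N M f x → c * N * M * (f * x) ≡ M * f * (c * (N * x))
    regroup = solve-∀
  ... | inj₂ n<M = 1 , ≤-reflexive (trans (cong (_+ 1) (m≤n⇒m⊓n≡m (<⇒≤ n<M))) (trans (+-comm n 1) (sym (m≤n⇒m⊓n≡m n<M)))) , (begin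
    weight * (n ! * cost tN b)
      ≤⟨ *-monoʳ-≤ weight (*-monoʳ-≤ (n !) (≤-trans (≤-reflexive (cost-counts tN (toList v))) (sum-map-≤ (depth tN) (depth-≤ tN) v))) ⟩
    weight * (n ! * (suc n * m))
      ≡⟨ regroup weight (n !) n m ⟩
    suc n ! * (weight * m * 1)
      ≤⟨ *-monoʳ-≤ (suc n !) (m≤n+m (weight * m * 1) e) ⟩
    suc n ! * (e + weight * m * 1)
      ≤⟨ m≤n+m _ (weight * (n ! * cost t b)) ⟩
    weight * (n ! * cost t b) + suc n ! * (e + weight * m * 1) ∎)
    where
    b = counts (toList v)
    e = 2 * m * (variation v + m * (c * c))
    regroup : ∀ W f n m → W * (f * (suc n * m)) ≡ suc n * f * (W * m * 1)
    regroup = solve-∀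

  -- A majorant for the accumulated step errors with `n` elements left and current variation `x`.
  -- The variation persists over `n` steps and grows on average by at most `m * (N * N)` per step,
  -- whence the quadratic term; `n ⊓ M` counts the crude steps.
  regret : ℕ → ℕ → ℕ
  regret n x = 2 * m * n * x + (2 * m * (n * n * (m * (N * N)) + n * (m * (c * c))) + weight * m * (n ⊓ M))

  regret-suc : ∀ n x j → n ⊓ M + j ≤ suc n ⊓ M →
    2 * m * (x + m * (c * c)) + weight * m * j + regret n (x + m * (N * N)) ≤ regret (suc n) x
  regret-suc n x j j≤ = begin
    2 * m * (x + m * (c * c)) + weight * m * j + regret n (x + m * (N * N))
      -- The added term raises the coefficient n² + n to the square of `suc n`.
      ≤⟨ m≤m+n _ (2 * m * suc n * (m * (N * N))) ⟩
    2 * m * (x + m * (c * c)) + weight * m * j + regret n (x + m * (N * N)) + 2 * m * suc n * (m * (N * N))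
      ≡⟨ regroup (2 * m) n x (m * (c * c)) (m * (N * N)) (weight * m) j (n ⊓ M) ⟩
    2 * m * suc n * x + (2 * m * (suc n * suc n * (m * (N * N)) + suc n * (m * (c * c))) + weight * m * (n ⊓ M + j))
      ≤⟨ +-monoʳ-≤ (2 * m * suc n * x) (+-monoʳ-≤ (2 * m * (suc n * suc n * (m * (N * N)) + suc n * (m * (c * c)))) (*-monoʳ-≤ (weight * m) j≤)) ⟩
    regret (suc n) x ∎
    where
    regroup : ∀ E n x Q T W j p →
      E * (x + Q) + W * j + (E * n * (x + T) + (E * (n * n * T + n * Q) + W * p)) + E * suc n * T
        ≡ E * suc n * x + (E * (suc n * suc n * T + suc n * Q) + W * (p + j))
    regroup = solve-∀

  -- `regret n` is affine in the variation, so averaging passes inside it.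
  sumRemove-regret : (v : Vec (Fin m) (suc n)) →
    sumRemove (λ _ u → regret n (variation u)) v ≤ suc n * regret n (variation v + m * (N * N))
  sumRemove-regret {n} v = begin
    sumRemove (λ _ u → regret n (variation u)) v
      ≡⟨ sumRemove-+ (λ _ u → 2 * m * n * variation u) (λ _ _ → κ) v ⟩
    sumRemove (λ _ u → 2 * m * n * variation u) v + sumRemove (λ _ _ → κ) v
      ≡⟨ cong₂ _+_ (sumRemove-*ˡ (2 * m * n) (λ _ u → variation u) v) (sumRemove-const κ v) ⟩
    2 * m * n * sumRemove (λ _ u → variation u) v + suc n * κ
      ≤⟨ +-monoˡ-≤ (suc n * κ) (*-monoʳ-≤ (2 * m * n) (sumRemove-variation v)) ⟩
    2 * m * n * (suc n * (variation v + m * (N * N))) + suc n * κ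
      ≡⟨ cong (_+ suc n * κ) (x∙yz≈y∙xz-* (2 * m * n) (suc n) _) ⟩
    suc n * (2 * m * n * (variation v + m * (N * N))) + suc n * κ
      ≡⟨ *-distribˡ-+ (suc n) (2 * m * n * (variation v + m * (N * N))) κ ⟨
    suc n * regret n (variation v + m * (N * N)) ∎
    where
    κ = 2 * m * (n * n * (m * (N * N)) + n * (m * (c * c))) + weight * m * (n ⊓ M)

  -- Both strategies are compared on the same remaining elements, with `tO hist` as competitor of
  -- `tN`; the excess of this step and the averaged later regret add up to the next regret.
  sumN≤sumO+regret : ∀ hist (v : Vec (Fin m) n) → Remaining hist v →
    weight * sumN v ≤ weight * sumO hist v + n ! * regret n (variation v)
  sumN≤sumO+regret {zero} hist v rem = ≤-trans (≤-reflexive (*-zeroʳ weight)) z≤n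
  sumN≤sumO+regret {suc n} hist v rem with step-excess v (tO hist)
  ... | j , j≤ , step = begin
    weight * sumN v
      ≡⟨ trans (cong (weight *_) (sumN-suc v)) (*-distribˡ-+ weight (n ! * cost tN b) _) ⟩
    weight * (n ! * cost tN b) + weight * sumRemove (λ _ u → sumN u) v
      ≤⟨ +-mono-≤ step later ⟩
    weight * (n ! * cost (tO hist) b) + suc n ! * e
      + (weight * sumRemove (λ x u → sumO (x ∷ hist) u) v + suc n ! * regret n (variation v + m * (N * N)))
      ≡⟨ regroup weight (n ! * cost (tO hist) b) _ (suc n !) e _ ⟩
    weight * (n ! * cost (tO hist) b + sumRemove (λ x u → sumO (x ∷ hist) u) v)
      + suc n ! * (e + regret n (variation v + m * (N * N)))
      ≤⟨ +-mono-≤ (≤-reflexive (cong (weight *_) (sym (sumO-suc hist v))))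
           (*-monoʳ-≤ (suc n !) (regret-suc n (variation v) j j≤)) ⟩
    weight * sumO hist v + suc n ! * regret (suc n) (variation v) ∎
    where
    b = counts (toList v)
    e = 2 * m * (variation v + m * (c * c)) + weight * m * j
    regroup : ∀ W x y f e g → W * x + f * e + (W * y + f * g) ≡ W * (x + y) + f * (e + g)
    regroup = solve-∀
    later : weight * sumRemove (λ _ u → sumN u) v
      ≤ weight * sumRemove (λ x u → sumO (x ∷ hist) u) v + suc n ! * regret n (variation v + m * (N * N))
    later = begin
      weight * sumRemove (λ _ u → sumN u) v
        ≡⟨ sumRemove-*ˡ weight (λ _ u → sumN u) v ⟨
      sumRemove (λ _ u → weight * sumN u) v
        ≤⟨ sumRemove-mono v (λ {x} {u} r → sumN≤sumO+regret (x ∷ hist) u (remaining-removal hist rem r)) ⟩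
      sumRemove (λ x u → weight * sumO (x ∷ hist) u + n ! * regret n (variation u)) v
        ≡⟨ sumRemove-+ (λ x u → weight * sumO (x ∷ hist) u) (λ _ u → n ! * regret n (variation u)) v ⟩
      sumRemove (λ x u → weight * sumO (x ∷ hist) u) v + sumRemove (λ _ u → n ! * regret n (variation u)) v
        ≡⟨ cong₂ _+_ (sumRemove-*ˡ weight (λ x u → sumO (x ∷ hist) u) v) (sumRemove-*ˡ (n !) (λ _ u → regret n (variation u)) v) ⟩
      weight * sumRemove (λ x u → sumO (x ∷ hist) u) v + n ! * sumRemove (λ _ u → regret n (variation u)) v
        ≤⟨ +-monoʳ-≤ _ (*-monoʳ-≤ (n !) (sumRemove-regret v)) ⟩
      weight * sumRemove (λ x u → sumO (x ∷ hist) u) v + n ! * (suc n * regret n (variation v + m * (N * N)))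
        ≡⟨ cong (weight * sumRemove (λ x u → sumO (x ∷ hist) u) v +_) (trans (x∙yz≈y∙xz-* (n !) (suc n) _) (sym (*-assoc (suc n) (n !) _))) ⟩
      weight * sumRemove (λ x u → sumO (x ∷ hist) u) v + suc n ! * regret n (variation v + m * (N * N)) ∎

  variation-initial : (v : Vec (Fin m) N) → Remaining [] v → variation v ≡ 0
  variation-initial v rem = ∑-zero λ i → cong square (m≡n⇒∣m-n∣≡0 (cong (N *_)
    (trans (cong (_+ count (toList v) i) (sym (lookup-replicate i 0))) (rem i))))

-- Choice of the parameters

regretConstant : ℕ → ℕ
regretConstant m = 544 * (m * m) + m

-- With N = O(s⁴), the choices c = N s² and M = s³ balance the terms of the regret.
regret-≤ : ∀ m N s → N ≤ 16 * s ^ 4 →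
  let c = N * s ^ 2 ; M = s ^ 3 ; W = c * N * M in
  2 * m * N * 0 + (2 * m * (N * N * (m * (N * N)) + N * (m * (c * c))) + W * m * (N ⊓ M))
    ≤ W * (regretConstant m * s ^ 3)
regret-≤ m N s N≤ = begin
  2 * m * N * 0 + (2 * m * (N * N * (m * (N * N)) + N * (m * (c * c))) + W * m * (N ⊓ M))
    ≡⟨ cong₂ (λ x y → x + (2 * m * y + W * m * (N ⊓ M))) (*-zeroʳ (2 * m * N)) (regroup m N s) ⟩
  2 * m * (m * (N * N) * (N * N) + m * (N * N) * (N * s ^ 4)) + W * m * (N ⊓ M)
    ≤⟨ +-mono-≤
         (*-monoʳ-≤ (2 * m) (+-mono-≤ (*-monoʳ-≤ (m * (N * N)) (*-mono-≤ N≤ N≤)) (*-monoʳ-≤ (m * (N * N)) (*-monoˡ-≤ (s ^ 4) N≤))))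
         (*-monoʳ-≤ (W * m) (m⊓n≤n N M)) ⟩
  2 * m * (m * (N * N) * (16 * s ^ 4 * (16 * s ^ 4)) + m * (N * N) * (16 * s ^ 4 * s ^ 4)) + W * m * M
    -- Both sides are multiples of N² s⁸, because `W * s ^ 3` equals N² s⁸. The constant is 544 = 2
    -- (16² + 16), and the extra `m` comes from the crude steps.
    ≡⟨ collect m N s ⟩
  W * (regretConstant m * s ^ 3) ∎
  where
  open ≤-Reasoning
  c = N * s ^ 2
  M = s ^ 3
  W = c * N * M
  regroup : ∀ m N s → N * N * (m * (N * N)) + N * (m * (N * (s * (s * 1)) * (N * (s * (s * 1)))))
    ≡ m * (N * N) * (N * N) + m * (N * N) * (N * (s * (s * (s * (s * 1)))))
  regroup = solve-∀
  collect : ∀ m N s →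
    2 * m * (m * (N * N) * (16 * (s * (s * (s * (s * 1)))) * (16 * (s * (s * (s * (s * 1))))))
      + m * (N * N) * (16 * (s * (s * (s * (s * 1)))) * (s * (s * (s * (s * 1))))))
      + N * (s * (s * 1)) * N * (s * (s * (s * 1))) * m * (s * (s * (s * 1)))
    ≡ N * (s * (s * 1)) * N * (s * (s * (s * 1))) * ((544 * (m * m) + m) * (s * (s * (s * 1))))
  collect = solve-∀

^-distribʳ-* : ∀ e x y → (x * y) ^ e ≡ x ^ e * y ^ e
^-distribʳ-* zero x y = refl
^-distribʳ-* (suc e) x y = trans (cong (x * y *_) (^-distribʳ-* e x y)) (interchange-* x y (x ^ e) (y ^ e))

-- With `s` in place of n^(1/4), the quantities √n and n^(3/4) become the integer powers `s ^ 2` and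
-- `s ^ 3`.
fourthRoot : ∀ n → Σ ℕ λ s → s ^ 4 ≤ n × n < suc s ^ 4
fourthRoot zero = 0 , z≤n , s≤s z≤n
fourthRoot (suc n) with fourthRoot n
... | s , s⁴≤n , n<[1+s]⁴ with ≤-<-connex (suc s ^ 4) (suc n)
...   | inj₁ [1+s]⁴≤1+n = suc s , [1+s]⁴≤1+n , ≤-<-trans n<[1+s]⁴ (^-monoˡ-< 4 (n<1+n (suc s)))
...   | inj₂ 1+n<[1+s]⁴ = s , m≤n⇒m≤1+n s⁴≤n , 1+n<[1+s]⁴

-- Reduction to fixed pivots

groupSeq-++ : ∀ {k} (ps : Vec ℕ k) l → groupSeq k (toList ps ++ l) ≡ List.map (group ps) l
groupSeq-++ {k} ps l = cong₂ (λ qs → List.map (group qs)) (takeV-++ ps) (drop-++ ps)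
  where
  takeV-++ : ∀ {k} (ps : Vec ℕ k) → takeV k (toList ps ++ l) ≡ ps
  takeV-++ [] = refl
  takeV-++ (p ∷ ps) = cong (p ∷_) (takeV-++ ps)
  drop-++ : ∀ {k} (ps : Vec ℕ k) → List.drop k (toList ps ++ l) ≡ l
  drop-++ [] = refl
  drop-++ (p ∷ ps) = drop-++ ps

module FixedPivots {k r : ℕ} (selN : SelectorN k) (selO : SelectorO k) (ps : Vec ℕ k) (w : Vec ℕ r) where

  groups : Vec (Fin (suc k)) r
  groups = Vec.map (group ps) w

  sizes₀ : Vec ℕ (suc k)
  sizes₀ = counts (toList groups)

  counts-arrangement : ∀ {l} → Arrangement l groups → counts l ≡ sizes₀
  counts-arrangement arr = lookup-ext (count-arrangement arr)

  tN : Tree (suc k)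
  tN = proj₁ (selN sizes₀)

  tO : List (Fin (suc k)) → Tree (suc k)
  tO hist = proj₁ (selO sizes₀ hist)

  module C = Comparison r sizes₀ tN (proj₂ (selN sizes₀)) tO (λ hist → proj₂ (selO sizes₀ hist))

  remaining : ∀ i → count [] i + count (toList groups) i ≡ lookup sizes₀ i
  remaining i = cong (_+ count (toList groups) i) (lookup-replicate i 0)

  sum-costN : sumPerm (λ l → costN k selN (toList ps ++ l)) w ≡ sumPerm (λ gs → sum (List.map (depth tN) gs)) groups
  sum-costN = begin-equality
    sumPerm (λ l → costN k selN (toList ps ++ l)) w   ≡⟨ sumPerm-cong w (λ {l} _ → cong costOf (groupSeq-++ ps l)) ⟩
    sumPerm (costOf ∘ List.map (group ps)) w          ≡⟨ sumPerm-map (group ps) costOf w ⟩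
    sumPerm costOf groups                             ≡⟨ sumPerm-cong groups (λ {gs} arr →
                                                           cong (λ a → sum (List.map (depth (proj₁ (selN a))) gs)) (counts-arrangement arr)) ⟩
    sumPerm (λ gs → sum (List.map (depth tN) gs)) groups ∎
    where
    open ≤-Reasoning
    costOf : List (Fin (suc k)) → ℕ
    costOf gs = sum (List.map (depth (proj₁ (selN (counts gs)))) gs)

  sum-costO : sumPerm (λ l → costO k selO (toList ps ++ l)) w ≡ sumPerm (run tO []) groups
  sum-costO = begin-equality
    sumPerm (λ l → costO k selO (toList ps ++ l)) w   ≡⟨ sumPerm-cong w (λ {l} _ → trans (costO-run k selO (toList ps ++ l)) (cong costOf (groupSeq-++ ps l))) ⟩
    sumPerm (costOf ∘ List.map (group ps)) w          ≡⟨ sumPerm-map (group ps) costOf w ⟩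
    sumPerm costOf groups                             ≡⟨ sumPerm-cong groups (λ {gs} arr →
                                                           cong (λ a → run (λ hist → proj₁ (selO a hist)) [] gs) (counts-arrangement arr)) ⟩
    sumPerm (run tO []) groups                        ∎
    where
    open ≤-Reasoning
    costOf : List (Fin (suc k)) → ℕ
    costOf gs = run (λ hist → proj₁ (selO (counts gs) hist)) [] gs

  costO≤costN : sumPerm (λ l → costO k selO (toList ps ++ l)) w ≤ sumPerm (λ l → costN k selN (toList ps ++ l)) w
  -- The two zeros are placeholder values for `c` and `M`, which shape the error of the reverse
  -- inequality.
  costO≤costN = subst₂ _≤_ (sym sum-costO) (sym sum-costN) (C.sumO≤sumN 0 0 [] groups remaining)

  costN≤costO : ∀ s .{{_ : NonZero r}} .{{_ : NonZero s}} → r ≤ 16 * s ^ 4 →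
    sumPerm (λ l → costN k selN (toList ps ++ l)) w
      ≤ sumPerm (λ l → costO k selO (toList ps ++ l)) w + r ! * (regretConstant (suc k) * s ^ 3)
  costN≤costO s r≤ = subst₂ (λ x y → x ≤ y + r ! * b) (sym sum-costN) (sym sum-costO)
    -- The common denominator is removed here; it is positive because `r` and `s` are.
    (*-cancelˡ-≤ W {{W≢0}} (begin
      W * sumN groups                                      ≤⟨ sumN≤sumO+regret [] groups remaining ⟩
      W * sumO [] groups + r ! * regret r (variation groups) ≡⟨ cong (λ x → W * sumO [] groups + r ! * regret r x) (variation-initial groups remaining) ⟩
      W * sumO [] groups + r ! * regret r 0                ≤⟨ +-monoʳ-≤ (W * sumO [] groups) (*-monoʳ-≤ (r !) (regret-≤ (suc k) r s r≤)) ⟩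
      W * sumO [] groups + r ! * (W * b)                   ≡⟨ cong (W * sumO [] groups +_) (x∙yz≈y∙xz-* (r !) W b) ⟩
      W * sumO [] groups + W * (r ! * b)                   ≡⟨ *-distribˡ-+ W (sumO [] groups) (r ! * b) ⟨
      W * (sumO [] groups + r ! * b)                       ∎))
    where
    open ≤-Reasoning
    open C (r * s ^ 2) (s ^ 3)
    b = regretConstant (suc k) * s ^ 3
    W = weight
    W≢0 : NonZero W
    W≢0 = m*n≢0 (r * s ^ 2 * r) (s ^ 3) {{m*n≢0 (r * s ^ 2) r {{m*n≢0 r (s ^ 2) {{it}} {{m^n≢0 s 2}}}}}} {{m^n≢0 s 3}}

toVec : ∀ (l : List A) → List.length l ≡ n → Σ (Vec A n) λ v → toList v ≡ l
toVec l refl = fromList l , toList∘fromList l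

-- Totals over all inputs

module _ {k r : ℕ} (selN : SelectorN k) (selO : SelectorO k) where

  private
    inputs : Σ (Vec ℕ (k + r)) λ v → toList v ≡ oneTo (k + r)
    inputs = toVec (oneTo (k + r)) (trans (List.length-map suc (List.upTo (k + r))) (List.length-upTo (k + r)))

    total : ∀ f → sum (List.map f (permutations (oneTo (k + r)))) ≡ sumPerm f (proj₁ inputs)
    total f = trans (cong (λ l → sum (List.map f (permutations l))) (sym (proj₂ inputs))) (sum-permutations f (proj₁ inputs))

  totalO≤totalN : totalO k (k + r) selO ≤ totalN k (k + r) selN
  totalO≤totalN = subst₂ _≤_ (sym (total _))
    (trans (cong (sumPerm (costN k selN) (proj₁ inputs) +_) (*-zeroʳ ((k + r) !))) (trans (+-identityʳ _) (sym (total _))))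
    (sumPerm-prefix-≤ k (costO k selO) (costN k selN) 0
      (λ ps w → ≤-trans (FixedPivots.costO≤costN selN selO ps w) (m≤m+n _ _)) (proj₁ inputs))

  totalN≤totalO : ∀ s .{{_ : NonZero r}} .{{_ : NonZero s}} → r ≤ 16 * s ^ 4 →
    totalN k (k + r) selN ≤ totalO k (k + r) selO + (k + r) ! * (regretConstant (suc k) * s ^ 3)
  totalN≤totalO s r≤ = subst₂ (λ x y → x ≤ y + (k + r) ! * (regretConstant (suc k) * s ^ 3)) (sym (total _)) (sym (total _))
    (sumPerm-prefix-≤ k (costN k selN) (costO k selO) (regretConstant (suc k) * s ^ 3)
      (λ ps w → FixedPivots.costN≤costO selN selO ps w s r≤) (proj₁ inputs))

theorem5p3 : ∀ (k : ℕ) → 1 ≤ k →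
    Σ ℕ λ p → Σ ℕ λ q → Σ ℕ λ C → Σ ℕ λ n₀ →
    (0 < p) × (p < q) ×
    (∀ (n : ℕ) → n₀ ≤ n → k < n →
    (selN : SelectorN k) → (selO : SelectorO k) →
    ∣ totalN k n selN - totalO k n selO ∣ ^ q ≤ (C * n !) ^ q * n ^ (q ∸ p))
-- The exponent is ε = 1/4: the fourth power of a difference of at most C n! n^(3/4) is an integer
-- statement. The threshold is 0 because the estimate holds for every n > k.
theorem5p3 k _ = 1 , 4 , C , 0 , s≤s z≤n , s≤s (s≤s z≤n) , bound
  where
  open ≤-Reasoning
  C = regretConstant (suc k)

  bound : ∀ n → 0 ≤ n → k < n → (selN : SelectorN k) (selO : SelectorO k) →
    ∣ totalN k n selN - totalO k n selO ∣ ^ 4 ≤ (C * n !) ^ 4 * n ^ 3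
  bound n _ k<n selN selO with m≤n⇒∃[o]m+o≡n (<⇒≤ k<n) | fourthRoot n
  ... | r , refl | zero , _ , n<1 = contradiction (≤-trans k<n (s≤s⁻¹ n<1)) λ ()
  ... | zero , refl | _ = contradiction (<-≤-trans k<n (≤-reflexive (+-identityʳ k))) (n≮n k)
  ... | r@(suc _) , refl | s@(suc _) , s⁴≤n , n<[1+s]⁴ = begin
    ∣ totalN k n selN - totalO k n selO ∣ ^ 4   ≤⟨ ^-monoˡ-≤ 4 difference ⟩
    (C * n ! * s ^ 3) ^ 4                       ≡⟨ ^-distribʳ-* 4 (C * n !) (s ^ 3) ⟩
    (C * n !) ^ 4 * (s ^ 3) ^ 4                 ≡⟨ cong ((C * n !) ^ 4 *_) (trans (^-*-assoc s 3 4) (sym (^-*-assoc s 4 3))) ⟩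
    (C * n !) ^ 4 * (s ^ 4) ^ 3                 ≤⟨ *-monoʳ-≤ ((C * n !) ^ 4) (^-monoˡ-≤ 3 s⁴≤n) ⟩
    (C * n !) ^ 4 * n ^ 3                       ∎
    where
    r≤ : r ≤ 16 * s ^ 4
    r≤ = begin
      r            ≤⟨ m≤n+m r k ⟩
      n            ≤⟨ <⇒≤ n<[1+s]⁴ ⟩
      -- Since `s` is positive, `suc s` is at most `2 * s`; this is the source of the factor 16.
      suc s ^ 4    ≤⟨ ^-monoˡ-≤ 4 (≤-trans (+-monoˡ-≤ s (s≤s z≤n)) (≤-reflexive (cong (s +_) (sym (+-identityʳ s))))) ⟩
      (2 * s) ^ 4  ≡⟨ ^-distribʳ-* 4 2 s ⟩
      16 * s ^ 4   ∎
    difference : ∣ totalN k n selN - totalO k n selO ∣ ≤ C * n ! * s ^ 3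
    difference = begin
      ∣ totalN k n selN - totalO k n selO ∣     ≡⟨ m≤n⇒∣n-m∣≡n∸m (totalO≤totalN selN selO) ⟩
      totalN k n selN ∸ totalO k n selO         ≤⟨ m≤n+o⇒m∸n≤o (totalN k n selN) (totalO k n selO) (totalN≤totalO selN selO s r≤) ⟩
      n ! * (C * s ^ 3)                         ≡⟨ x∙yz≈y∙xz-* (n !) C (s ^ 3) ⟩
      C * (n ! * s ^ 3)                         ≡⟨ *-assoc C (n !) (s ^ 3) ⟨
      C * n ! * s ^ 3                           ∎
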